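{- For every vertex $s$ of $G$ we have the equality of formal power series \[\mathcal{R}(G;y)=\frac{\mathcal{P}(G,s;y)}{1-y}.\] In particular, since the left-hand side does not depend on $s$, the polynomial $\mathcal{P}(G,s;y)$ is independent of the choice of $s$.
   Context: Let $G=(V,E)$ be a finite strongly connected digraph (loops and multiple edges allowed). Sinkless sandpile model: a chip configuration is $\mathbf{c}\in\mathbb{N}_0^V$; firing a vertex $v$ removes $\deg^+_G(v)$ chips from $v$ and sends one chip along each outgoing edge; the firing is legal if $\mathbf{c}(v)\ge \deg^+_G(v)$. Write $\mathbf{c}\rightsquigarrow\mathbf{d}$ if $\mathbf{d}$ is obtained from $\mathbf{c}$ by a finite sequence of legal firings. $\mathbf{c}$ is recurrent if it is unstable and $\mathbf{d}\rightsquigarrow\mathbf{c}$ for every $\mathbf{d}$ with $\mathbf{c}\rightsquigarrow\mathbf{d}$. On the set $\mathrm{Rec}(G)$ of recurrent configurations, $\mathbf{c}\sim\mathbf{d}$ iff $\mathbf{c}\rightsquigarrow\mathbf{d}$ (an equivalence relation). The level of a class is the total number of chips $\sum_v \mathbf{c}(v)$; $\mathrm{Rec}_n(G,\sim)$ is the set of classes of level $n$, and $\mathcal{R}(G;y)=\sum_{n\ge0}|\mathrm{Rec}_n(G,\sim)|\,y^n$. Sandpile model with sink $s\in V$: an $s$-configuration is $\widehat{\mathbf{c}}\in\mathbb{N}_0^{V\setminus\{s\}}$; vertices other than $s$ fire as before, chips sent to $s$ are lost, $s$ never fires; every $s$-configuration stabilizes to a unique stable $\widehat{\mathbf{c}}^\circ$.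 $\widehat{\mathbf{c}}$ is $s$-recurrent if for every $s$-configuration $\widehat{\mathbf{c}}_1$ there is $\widehat{\mathbf{c}}_2$ with $(\widehat{\mathbf{c}}_1+\widehat{\mathbf{c}}_2)^\circ=\widehat{\mathbf{c}}$. Let $\mathbf{u}_s(v)$ be the number of edges from $s$ to $v$. On $s$-recurrent configurations, $\widehat{\mathbf{c}}\sim_s\widehat{\mathbf{d}}$ iff $\widehat{\mathbf{d}}=(\widehat{\mathbf{c}}+k\mathbf{u}_s)^\circ$ for some $k\in\mathbb{N}_0$. For an $s$-configuration $\widehat{\mathbf{c}}$, let $\overline{\mathbf{c}}\in\mathbb{N}_0^V$ extend it by $\overline{\mathbf{c}}(s)=0$, and $\mathbf{1}_s$ the indicator of $s$. The $s$-index $\chi(\widehat{\mathbf{c}})$ is the least $k$ with $\overline{\mathbf{c}}+k\mathbf{1}_s$ recurrent in the sinkless model, and the $s$-level is $\mathrm{slvl}(\widehat{\mathbf{c}})=\chi(\widehat{\mathbf{c}})+\sum_{v\ne s}\widehat{\mathbf{c}}(v)$ (constant on $\sim_s$-classes). With $\mathrm{Rec}_n(G,\sim_s)$ the $\sim_s$-classes of $s$-level $n$, $\mathcal{P}(G,s;y)=\sum_{n\ge0}|\mathrm{Rec}_n(G,\sim_s)|\,y^n$ (a polynomial). -}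

module Defs where

open import Data.Nat using (ℕ; zero; suc; _+_; _*_; _∸_; _≤_; _<_)
open import Data.Fin using (Fin; _≟_)
open import Data.Vec using (Vec; lookup; tabulate; sum; _[_]≔_; zipWith)
open import Data.Product using (Σ; ∃; _×_)
open import Relation.Nullary using (¬_; yes; no)
open import Relation.Binary.PropositionalEquality using (_≡_; _≢_)
open import Relation.Binary.Construct.Closure.ReflexiveTransitive using (Star)

-- Digraphs on vertex set Fin N, given by edge multiplicities:
-- A u v = number of edges from u to v (loops and multiple edges allowed).

Digraph : ℕ → Set
Digraph N = Fin N → Fin N → ℕ

Path : ∀ {N} → Digraph N → Fin N → Fin N → Set
Path A = Star (λ x y → 0 < A x y)

StronglyConnected : ∀ {N} → Digraph N → Set
StronglyConnected {N} A = (u v : Fin N) → Path A u v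

outdeg : ∀ {N} → Digraph N → Fin N → ℕ
outdeg {N} A v = sum (tabulate (A v))

Config : ℕ → Set
Config N = Vec ℕ N

level : ∀ {N} → Config N → ℕ
level c = sum c

-- result of firing v (only used when legal, so ∸ is exact)
fire : ∀ {N} → Digraph N → Config N → Fin N → Config N
fire A c v = tabulate λ w → own w + A v w
  where
  own : _ → ℕ
  own w with w ≟ v
  ... | yes _ = lookup c w ∸ outdeg A v
  ... | no  _ = lookup c w

Step : ∀ {N} → Digraph N → Config N → Config N → Set
Step A c d = ∃ λ v → outdeg A v ≤ lookup c v × d ≡ fire A c v

Reach : ∀ {N} → Digraph N → Config N → Config N → Set
Reach A = Star (Step A)

Unstable : ∀ {N} → Digraph N → Config N → Set
Unstable A c = ∃ λ v → outdeg A v ≤ lookup c v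

Recurrent : ∀ {N} → Digraph N → Config N → Set
Recurrent A c = Unstable A c × (∀ d → Reach A c d → Reach A d c)

-- Sandpile model with sink s.
-- An s-configuration ĉ ∈ ℕ₀^(V∖{s}) is represented by its extension
-- c̄ ∈ ℕ₀^V with c̄(s) = 0 (predicate SConfig).

SConfig : ∀ {N} → Fin N → Config N → Set
SConfig s c = lookup c s ≡ 0

sfire : ∀ {N} → Digraph N → Fin N → Config N → Fin N → Config N
sfire A s c v = tabulate λ w → kill w
  where
  kill : _ → ℕ
  kill w with w ≟ s
  ... | yes _ = 0
  ... | no  _ = lookup (fire A c v) w

SStep : ∀ {N} → Digraph N → Fin N → Config N → Config N → Set
SStep A s c d = ∃ λ v → v ≢ s × outdeg A v ≤ lookup c v × d ≡ sfire A s c v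

SReach : ∀ {N} → Digraph N → Fin N → Config N → Config N → Set
SReach A s = Star (SStep A s)

SStable : ∀ {N} → Digraph N → Fin N → Config N → Set
SStable A s c = ∀ v → v ≢ s → lookup c v < outdeg A v

-- Stabilizes A s c d  :  c° = d  (stabilization, which is unique)
Stabilizes : ∀ {N} → Digraph N → Fin N → Config N → Config N → Set
Stabilizes A s c d = SReach A s c d × SStable A s d

_⊕_ : ∀ {N} → Config N → Config N → Config N
_⊕_ = zipWith _+_

SRecurrent : ∀ {N} → Digraph N → Fin N → Config N → Set
SRecurrent A s c =
  SConfig s c ×
  (∀ c₁ → SConfig s c₁ → Σ (Config _) λ c₂ → SConfig s c₂ × Stabilizes A s (c₁ ⊕ c₂) c)

us : ∀ {N} → Digraph N → Fin N → Config N
us A s = tabulate λ w → f w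
  where
  f : _ → ℕ
  f w with w ≟ s
  ... | yes _ = 0
  ... | no  _ = A s w

scale : ∀ {N} → ℕ → Config N → Config N
scale k c = tabulate λ w → k * lookup c w

SEquiv : ∀ {N} → Digraph N → Fin N → Config N → Config N → Set
SEquiv A s c d = ∃ λ k → Stabilizes A s (c ⊕ scale k (us A s)) d

IsSIndex : ∀ {N} → Digraph N → Fin N → Config N → ℕ → Set
IsSIndex A s c k =
  Recurrent A (c [ s ]≔ k) × (∀ j → j < k → ¬ Recurrent A (c [ s ]≔ j))

SLevel : ∀ {N} → Digraph N → Fin N → Config N → ℕ → Set
SLevel A s c n = ∃ λ k → IsSIndex A s c k × n ≡ k + level c

-- "The set of R-classes of elements satisfying P has exactly m elements":
-- a system of m pairwise inequivalent representatives covering P.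

ClassCount : ∀ {N} → (Config N → Set) → (Config N → Config N → Set) → ℕ → Set
ClassCount {N} P R m =
  Σ (Fin m → Config N) λ f →
    (∀ i → P (f i)) ×
    (∀ i j → R (f i) (f j) → i ≡ j) ×
    (∀ c → P c → ∃ λ i → R c (f i))

RecCount : ∀ {N} → Digraph N → ℕ → ℕ → Set
RecCount A n = ClassCount (λ c → Recurrent A c × level c ≡ n) (Reach A)

SRecCount : ∀ {N} → Digraph N → Fin N → ℕ → ℕ → Set
SRecCount A s n = ClassCount (λ c → SRecurrent A s c × SLevel A s c n) (SEquiv A s)

sumUpTo : (ℕ → ℕ) → ℕ → ℕ
sumUpTo p zero = p zero
sumUpTo p (suc n) = sumUpTo p n + p (suc n)

{-# OPTIONS --safe #-}

-- A configuration is recurrent iff some legal firing sequence fires every vertex and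
-- returns to it; hence recurrence survives the addition of chips. In a run between
-- configurations ĉ + a·1_s and d̂ + b·1_s the k firings of s may be carried out first, which
-- turns it into a stabilisation of ĉ + k·u_s in the sink model; conversely a recurrent
-- configuration lets s fire as often as desired, and confluence of the sink model then leads
-- from ĉ + a·1_s to the stabilisation d̂ of ĉ + k·u_s. So ~ and ∼_s match, the s-level is
-- a class invariant, and sending ĉ of s-level k ≤ n to ĉ + (χ(ĉ) + n − k)·1_s is a
-- bijection from the ∼_s-classes of s-level at most n onto the recurrent classes of level n.
-- Every recurrent configuration is reached this way, for stabilising it off s leaves an
-- s-recurrent configuration plus chips at s.
module Submission where

open import Defs
open import Data.Nat using (ℕ; zero; suc; _+_; _*_; _∸_; _≤_; _<_; z≤n; _≤′_; ≤′-reflexive; ≤′-step; _≤?_; >-nonZero)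
open import Data.Nat.Properties hiding (_≟_)
open import Data.Nat.Induction using (<-rec)
open import Data.Nat.Solver using (module +-*-Solver)
open import Data.Fin using (Fin; zero; suc; _≟_; splitAt; _↑ˡ_; _↑ʳ_)
open import Data.Fin.Properties using (injective⇒≤; any?; splitAt-↑ˡ; splitAt-↑ʳ; splitAt⁻¹-↑ˡ; splitAt⁻¹-↑ʳ)
open import Data.List using (List; []; _∷_; _++_; length)
open import Data.Vec using ([]; _∷_; lookup; tabulate; sum; _[_]≔_; replicate; zipWith)
open import Data.Vec.Properties using (zipWith-comm; lookup∘tabulate; tabulate∘lookup; tabulate-cong; lookup-zipWith; lookup-replicate; lookup∘update; lookup∘update′; []≔-lookup; []≔-idempotent)
open import Data.Product using (Σ; ∃; _×_; _,_; proj₁; proj₂)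
open import Data.Sum using (_⊎_; inj₁; inj₂; [_,_]′)
open import Function using (_∘_)
open import Relation.Nullary using (¬_; yes; no; contradiction; ¬?; _×-dec_)
open import Relation.Nullary.Decidable using (decidable-stable)
open import Relation.Binary.PropositionalEquality using (_≡_; _≢_; refl; sym; trans; cong; cong₂; subst; subst₂; module ≡-Reasoning)
open import Relation.Binary.Construct.Closure.ReflexiveTransitive using (ε; _◅_; _◅◅_)

-- Arithmetic of chip configurations.

lookup-ext : ∀ {N} {c d : Config N} → (∀ w → lookup c w ≡ lookup d w) → c ≡ d
lookup-ext {c = c} {d} h =
  trans (sym (tabulate∘lookup c)) (trans (tabulate-cong h) (tabulate∘lookup d))

lookup-⊕ : ∀ {N} (c d : Config N) w → lookup (c ⊕ d) w ≡ lookup c w + lookup d w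
lookup-⊕ c d w = lookup-zipWith _+_ w c d

⊕-comm : ∀ {N} (c d : Config N) → c ⊕ d ≡ d ⊕ c
⊕-comm = zipWith-comm +-comm

lookup≤sum : ∀ {N} (c : Config N) w → lookup c w ≤ sum c
lookup≤sum (x ∷ c) zero    = m≤m+n x _
lookup≤sum (x ∷ c) (suc w) = ≤-trans (lookup≤sum c w) (m≤n+m _ x)

sum-⊕ : ∀ {N} (c d : Config N) → sum (c ⊕ d) ≡ sum c + sum d
sum-⊕ []      []      = refl
sum-⊕ (x ∷ c) (y ∷ d) rewrite sum-⊕ c d =
  solve 4 (λ x y a b → (x :+ y) :+ (a :+ b) := (x :+ a) :+ (y :+ b)) refl x y (sum c) (sum d)
  where open +-*-Solver

sum-mono : ∀ {N} (c d : Config N) → (∀ w → lookup c w ≤ lookup d w) → sum c ≤ sum d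
sum-mono []      []      h = z≤n
sum-mono (x ∷ c) (y ∷ d) h = +-mono-≤ (h zero) (sum-mono c d (h ∘ suc))

sum-[]≔ : ∀ {N} (c : Config N) s k → lookup c s ≡ 0 → sum (c [ s ]≔ k) ≡ k + sum c
sum-[]≔ (x ∷ c) zero    k refl = refl
sum-[]≔ (x ∷ c) (suc s) k eq rewrite sum-[]≔ c s k eq =
  solve 3 (λ x k a → x :+ (k :+ a) := k :+ (x :+ a)) refl x k (sum c)
  where open +-*-Solver

unit : ∀ {N} → Fin N → ℕ → Config N
unit s k = replicate _ 0 [ s ]≔ k

sum-replicate-0 : ∀ N → sum (replicate N 0) ≡ 0
sum-replicate-0 zero    = refl
sum-replicate-0 (suc N) = sum-replicate-0 N

sum-unit : ∀ {N} (s : Fin N) k → sum (unit s k) ≡ k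
sum-unit {N} s k = trans (sum-[]≔ (replicate N 0) s k (lookup-replicate s 0))
  (trans (cong (k +_) (sum-replicate-0 N)) (+-identityʳ k))

lookup-unit-≢ : ∀ {N} (s : Fin N) {w} k → w ≢ s → lookup (unit s k) w ≡ 0
lookup-unit-≢ s {w} k w≢s =
  trans (lookup∘update′ w≢s (replicate _ 0) k) (lookup-replicate w 0)

unit-⊕ : ∀ {N} (s : Fin N) j k → unit s j ⊕ unit s k ≡ unit s (j + k)
unit-⊕ s j k = lookup-ext pt
  where
  pt : ∀ w → lookup (unit s j ⊕ unit s k) w ≡ lookup (unit s (j + k)) w
  pt w with w ≟ s
  ... | yes refl = trans (lookup-⊕ (unit s j) (unit s k) w)
    (trans (cong₂ _+_ (lookup∘update s (replicate _ 0) j) (lookup∘update s (replicate _ 0) k))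
      (sym (lookup∘update s (replicate _ 0) (j + k))))
  ... | no w≢s = trans (lookup-⊕ (unit s j) (unit s k) w)
    (trans (cong₂ _+_ (lookup-unit-≢ s j w≢s) (lookup-unit-≢ s k w≢s))
      (sym (lookup-unit-≢ s (j + k) w≢s)))

[]≔-⊕-unit : ∀ {N} (c : Config N) s j k → (c [ s ]≔ j) ⊕ unit s k ≡ c [ s ]≔ (j + k)
[]≔-⊕-unit c s j k = lookup-ext pt
  where
  pt : ∀ w → lookup ((c [ s ]≔ j) ⊕ unit s k) w ≡ lookup (c [ s ]≔ (j + k)) w
  pt w with w ≟ s
  ... | yes refl = trans (lookup-⊕ (c [ s ]≔ j) (unit s k) w)
    (trans (cong₂ _+_ (lookup∘update s c j) (lookup∘update s (replicate _ 0) k))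
      (sym (lookup∘update s c (j + k))))
  ... | no w≢s = trans (lookup-⊕ (c [ s ]≔ j) (unit s k) w)
    (trans (cong₂ _+_ (lookup∘update′ w≢s c j) (lookup-unit-≢ s k w≢s))
      (trans (+-identityʳ _) (sym (lookup∘update′ w≢s c (j + k)))))

[]≔-sconfig : ∀ {N} (c : Config N) s k → SConfig s c → (c [ s ]≔ k) [ s ]≔ 0 ≡ c
[]≔-sconfig c s k cs = trans ([]≔-idempotent c s)
  (trans (cong (c [ s ]≔_) (sym cs)) ([]≔-lookup c s))

-- Kronecker delta: with it, the chips that firing `v` removes at any `w` are `ind v w * deg v`,
-- without a case split.
ind : ∀ {N} → Fin N → Fin N → ℕ
ind v w = lookup (unit v 1) w

ind-self : ∀ {N} (v : Fin N) → ind v v ≡ 1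
ind-self v = lookup∘update v (replicate _ 0) 1

ind-≢ : ∀ {N} {v w : Fin N} → w ≢ v → ind v w ≡ 0
ind-≢ {v = v} w≢v = lookup-unit-≢ v 1 w≢v

unit≡ind : ∀ {N} (v : Fin N) k w → lookup (unit v k) w ≡ ind v w * k
unit≡ind v k w with w ≟ v
... | yes refl rewrite ind-self v = trans (lookup∘update v (replicate _ 0) k) (sym (+-identityʳ k))
... | no w≢v   rewrite ind-≢ w≢v = lookup-unit-≢ v k w≢v

-- Legal firings in the sinkless model.

module Sandpile {N : ℕ} (A : Digraph N) where

  deg : Fin N → ℕ
  deg = outdeg A

  private
    -- The first component evaluates to the local function of fire, which has no name here.
    fire-at : ∀ c v w → ∃ λ x → lookup (fire A c v) w ≡ x
    fire-at c v w = _ , lookup∘tabulate _ w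

    fire-at≡ : ∀ c v w → proj₁ (fire-at c v w) ≡ (lookup c w ∸ ind v w * deg v) + A v w
    fire-at≡ c v w with w ≟ v
    ... | yes refl rewrite ind-self v | +-identityʳ (deg v) = refl
    ... | no w≢v   rewrite ind-≢ w≢v = refl

  lookup-fire : ∀ c v w → lookup (fire A c v) w ≡ (lookup c w ∸ ind v w * deg v) + A v w
  lookup-fire c v w = trans (proj₂ (fire-at c v w)) (fire-at≡ c v w)

  debt≤ : ∀ c {v} w → deg v ≤ lookup c v → ind v w * deg v ≤ lookup c w
  debt≤ c {v} w legal with w ≟ v
  ... | yes refl rewrite ind-self v | +-identityʳ (deg v) = legal
  ... | no w≢v   rewrite ind-≢ w≢v = z≤n

  -- With the debt moved to the left no truncated subtraction remains, so the semiring solver and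
  -- cancellation apply.
  fire-balance : ∀ c v w → deg v ≤ lookup c v →
    lookup (fire A c v) w + ind v w * deg v ≡ lookup c w + A v w
  fire-balance c v w legal = begin
    lookup (fire A c v) w + δ          ≡⟨ cong (_+ δ) (lookup-fire c v w) ⟩
    lookup c w ∸ δ + A v w + δ         ≡⟨ +-assoc (lookup c w ∸ δ) _ _ ⟩
    lookup c w ∸ δ + (A v w + δ)       ≡⟨ cong (lookup c w ∸ δ +_) (+-comm (A v w) δ) ⟩
    lookup c w ∸ δ + (δ + A v w)       ≡⟨ +-assoc (lookup c w ∸ δ) _ _ ⟨
    lookup c w ∸ δ + δ + A v w         ≡⟨ cong (_+ A v w) (m∸n+n≡m (debt≤ c w legal)) ⟩
    lookup c w + A v w                 ∎
    where
    open ≡-Reasoning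
    δ = ind v w * deg v

  -- The debt cancels, so the balance determines the result; `fire-⊕` and `fire-comm` follow by
  -- exhibiting such a balance.
  fire-unique : ∀ {c v d} → deg v ≤ lookup c v →
    (∀ w → lookup d w + ind v w * deg v ≡ lookup c w + A v w) → d ≡ fire A c v
  fire-unique {c} {v} {d} legal h = lookup-ext λ w →
    +-cancelʳ-≡ (ind v w * deg v) _ _ (trans (h w) (sym (fire-balance c v w legal)))

  fire-grows : ∀ c {v w} → w ≢ v → lookup c w ≤ lookup (fire A c v) w
  fire-grows c {v} {w} w≢v rewrite lookup-fire c v w | ind-≢ w≢v = m≤m+n _ _

  legal-⊕ : ∀ c x {v} → deg v ≤ lookup c v → deg v ≤ lookup (c ⊕ x) v
  legal-⊕ c x {v} legal rewrite lookup-⊕ c x v = ≤-trans legal (m≤m+n _ _)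

  fire-⊕ : ∀ c x {v} → deg v ≤ lookup c v → fire A (c ⊕ x) v ≡ fire A c v ⊕ x
  fire-⊕ c x {v} legal = sym (fire-unique (legal-⊕ c x legal) pt)
    where
    open +-*-Solver
    pt : ∀ w → lookup (fire A c v ⊕ x) w + ind v w * deg v ≡ lookup (c ⊕ x) w + A v w
    pt w rewrite lookup-⊕ (fire A c v) x w | lookup-⊕ c x w =
      trans (solve 3 (λ f y δ → (f :+ y) :+ δ := (f :+ δ) :+ y) refl
              (lookup (fire A c v) w) (lookup x w) (ind v w * deg v))
        (trans (cong (_+ lookup x w) (fire-balance c v w legal))
          (solve 3 (λ f y a → (f :+ a) :+ y := (f :+ y) :+ a) refl
              (lookup c w) (lookup x w) (A v w)))

  fire-comm : ∀ c {v w} → v ≢ w → deg v ≤ lookup c v → deg w ≤ lookup c w →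
    fire A (fire A c v) w ≡ fire A (fire A c w) v
  fire-comm c {v} {w} v≢w lv lw =
    sym (fire-unique (≤-trans lw (fire-grows c (v≢w ∘ sym))) pt)
    where
    open +-*-Solver
    pt : ∀ x → lookup (fire A (fire A c w) v) x + ind w x * deg w ≡ lookup (fire A c v) x + A w x
    -- The debt of `v` is added to both sides and paid off by three balances: `v` after `w`, `w`
    -- from `c`, and `v` from `c` read backwards.
    pt x = +-cancelʳ-≡ (ind v x * deg v) _ _
      (trans (swap (lookup (fire A (fire A c w) v) x) (ind w x * deg w) (ind v x * deg v))
      (trans (cong (_+ ind w x * deg w)
               (fire-balance (fire A c w) v x (≤-trans lv (fire-grows c v≢w))))
      (trans (swap (lookup (fire A c w) x) (A v x) (ind w x * deg w))
      (trans (cong (_+ A v x) (fire-balance c w x lw))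
      (trans (swap (lookup c x) (A w x) (A v x))
      (trans (cong (_+ A w x) (sym (fire-balance c v x lv)))
             (swap (lookup (fire A c v) x) (ind v x * deg v) (A w x))))))))
      where
      swap : ∀ a b d → (a + b) + d ≡ (a + d) + b
      swap = solve 3 (λ a b d → (a :+ b) :+ d := (a :+ d) :+ b) refl

  level-fire : ∀ c v → deg v ≤ lookup c v → level (fire A c v) ≡ level c
  level-fire c v legal = +-cancelʳ-≡ (deg v) _ _ (begin
    sum (fire A c v) + deg v                  ≡⟨ cong (sum (fire A c v) +_) (sum-unit v (deg v)) ⟨
    sum (fire A c v) + sum (unit v (deg v))   ≡⟨ sum-⊕ (fire A c v) _ ⟨
    sum (fire A c v ⊕ unit v (deg v))         ≡⟨ cong sum (lookup-ext {c = fire A c v ⊕ _} {c ⊕ _} pt) ⟩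
    sum (c ⊕ tabulate (A v))                  ≡⟨ sum-⊕ c _ ⟩
    sum c + deg v                             ∎)
    where
    open ≡-Reasoning
    pt : ∀ w → lookup (fire A c v ⊕ unit v (deg v)) w ≡ lookup (c ⊕ tabulate (A v)) w
    pt w rewrite lookup-⊕ (fire A c v) (unit v (deg v)) w | lookup-⊕ c (tabulate (A v)) w
      | unit≡ind v (deg v) w | lookup∘tabulate (A v) w = fire-balance c v w legal

  -- Firing sequences and the exchange property.

  infixr 5 _∷_

  -- `Reach` with the fired vertices exposed as an index, so that firings can be counted and
  -- reordered.
  data Run : Config N → List (Fin N) → Config N → Set where
    []  : ∀ {c} → Run c [] c
    _∷_ : ∀ {c v l d} → deg v ≤ lookup c v → Run (fire A c v) l d → Run c (v ∷ l) d

  count : Fin N → List (Fin N) → ℕ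
  count w []      = 0
  count w (v ∷ l) = ind v w + count w l

  count-++ : ∀ w l m → count w (l ++ m) ≡ count w l + count w m
  count-++ w []      m = refl
  count-++ w (v ∷ l) m rewrite count-++ w l m = sym (+-assoc (ind v w) _ _)

  run-++ : ∀ {c l d m e} → Run c l d → Run d m e → Run c (l ++ m) e
  run-++ []      q = q
  run-++ (x ∷ p) q = x ∷ run-++ p q

  run⇒reach : ∀ {c l d} → Run c l d → Reach A c d
  run⇒reach []      = ε
  run⇒reach (x ∷ p) = (_ , x , refl) ◅ run⇒reach p

  reach⇒run : ∀ {c d} → Reach A c d → ∃ λ l → Run c l d
  reach⇒run ε                       = [] , []
  reach⇒run ((v , x , refl) ◅ p) with reach⇒run p
  ... | l , q = v ∷ l , x ∷ q

  run-⊕ : ∀ {c l d} x → Run c l d → Run (c ⊕ x) l (d ⊕ x)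
  run-⊕ x []              = []
  run-⊕ x (_∷_ {c} {v} {l} legal p) =
    legal-⊕ c x legal ∷ subst (λ e → Run e l _) (sym (fire-⊕ c x legal)) (run-⊕ x p)

  level-run : ∀ {c l d} → Run c l d → level d ≡ level c
  level-run []                          = refl
  level-run (_∷_ {c} {v} legal p) = trans (level-run p) (level-fire c v legal)

  reach-⊕ : ∀ {c d} x → Reach A c d → Reach A (c ⊕ x) (d ⊕ x)
  reach-⊕ x = run⇒reach ∘ run-⊕ x ∘ proj₂ ∘ reach⇒run

  level-reach : ∀ {c d} → Reach A c d → level d ≡ level c
  level-reach = level-run ∘ proj₂ ∘ reach⇒run

  -- Conservation of chips at w, keeping only the chips that arrive from v.
  run-flow : ∀ {c l d} → Run c l d → ∀ v w →
    lookup c w + count v l * A v w ≤ lookup d w + count w l * deg w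
  run-flow [] v w = ≤-refl
  run-flow {c} {x ∷ l} {d} (legal ∷ p) v w = begin
    lookup c w + (ind x v + count v l) * A v w
      ≡⟨ solve 4 (λ c i n a → c :+ (i :+ n) :* a := c :+ i :* a :+ n :* a) refl (lookup c w) (ind x v) (count v l) (A v w) ⟩
    lookup c w + ind x v * A v w + count v l * A v w
      ≤⟨ +-monoˡ-≤ _ (+-monoʳ-≤ (lookup c w) (into v)) ⟩
    lookup c w + A x w + count v l * A v w
      ≡⟨ cong (_+ count v l * A v w) (fire-balance c x w legal) ⟨
    lookup (fire A c x) w + ind x w * deg x + count v l * A v w
      ≡⟨ cong (λ z → lookup (fire A c x) w + z + count v l * A v w) (out w) ⟩
    lookup (fire A c x) w + ind x w * deg w + count v l * A v w
      ≡⟨ solve 3 (λ a b c → (a :+ b) :+ c := (a :+ c) :+ b) refl (lookup (fire A c x) w) (ind x w * deg w) _ ⟩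
    lookup (fire A c x) w + count v l * A v w + ind x w * deg w
      ≤⟨ +-monoˡ-≤ (ind x w * deg w) (run-flow p v w) ⟩
    lookup d w + count w l * deg w + ind x w * deg w
      ≡⟨ solve 4 (λ d n g i → d :+ n :* g :+ i :* g := d :+ (i :+ n) :* g) refl (lookup d w) (count w l) (deg w) (ind x w) ⟩
    lookup d w + (ind x w + count w l) * deg w ∎
    where
    open ≤-Reasoning
    open +-*-Solver
    into : ∀ v → ind x v * A v w ≤ A x w
    into v with v ≟ x
    ... | yes refl rewrite ind-self v = ≤-reflexive (+-identityʳ _)
    ... | no v≢x   rewrite ind-≢ v≢x = z≤n
    out : ∀ w → ind x w * deg x ≡ ind x w * deg w
    out w with w ≟ x
    ... | yes refl = refl
    ... | no w≢x   rewrite ind-≢ w≢x = refl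

  -- Firing `v` never takes chips from other vertices, so the firings before its first occurrence
  -- stay legal after it and commute with it.
  exchange : ∀ {c l d v} → Run c l d → deg v ≤ lookup c v → 0 < count v l →
    ∃ λ l′ → Run (fire A c v) l′ d × (∀ w → count w l ≡ ind v w + count w l′)
  exchange {c} {x ∷ l} {d} {v} (legal ∷ p) lv v∈l with v ≟ x
  ... | yes refl = l , p , λ _ → refl
  ... | no v≢x with exchange p (≤-trans lv (fire-grows c v≢x))
                      (subst (λ i → 0 < i + count v l) (ind-≢ v≢x) v∈l)
  ... | l′ , q , h = x ∷ l′
      , ≤-trans legal (fire-grows c (v≢x ∘ sym))
        ∷ subst (λ e → Run e l′ d) (fire-comm c (v≢x ∘ sym) legal lv) q
      , λ w → trans (cong (ind x w +_) (h w))
          (solve 3 (λ a b n → a :+ (b :+ n) := b :+ (a :+ n)) refl (ind x w) (ind v w) (count w l′))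
    where open +-*-Solver

  -- Full cycles and recurrence.

  FullCycle : Config N → Set
  FullCycle c = ∃ λ l → Run c l c × (∀ w → 0 < count w l)

  cycle-⊕ : ∀ {c} x → FullCycle c → FullCycle (c ⊕ x)
  cycle-⊕ x (l , p , full) = l , run-⊕ x p , full

  -- `exchange` moves `v` to the front of the cycle. What follows leads back to `c`, and appending
  -- `v` there closes a cycle at the new configuration with the same counts.
  cycle-step : ∀ {c v} → FullCycle c → deg v ≤ lookup c v →
    FullCycle (fire A c v) × Reach A (fire A c v) c
  cycle-step {c} {v} (l , p , full) legal with exchange p legal (full v)
  ... | l′ , q , h = (l′ ++ v ∷ [] , run-++ q (legal ∷ []) , full′) , run⇒reach q
    where
    full′ : ∀ w → 0 < count w (l′ ++ v ∷ [])
    full′ w = subst (0 <_) (trans (h w) (trans (+-comm (ind v w) _)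
      (trans (cong (count w l′ +_) (sym (+-identityʳ (ind v w)))) (sym (count-++ w l′ _))))) (full w)

  cycle-return : ∀ {c d} → FullCycle c → Reach A c d → Reach A d c
  cycle-return cyc ε                        = ε
  cycle-return cyc ((v , legal , refl) ◅ p) with cycle-step cyc legal
  ... | cyc′ , back = cycle-return cyc′ p ◅◅ back

  -- The vertex `s` excludes the empty graph, where the empty run is vacuously a full cycle although
  -- nothing is unstable.
  cycle⇒recurrent : ∀ {c} → Fin N → FullCycle c → Recurrent A c
  cycle⇒recurrent s cyc@(_ ∷ _ , legal ∷ _ , _) = (_ , legal) , λ _ → cycle-return cyc
  cycle⇒recurrent s ([] , _ , full) = contradiction (full s) λ ()

  recurrent-reach : ∀ {c d} → Recurrent A c → Reach A c d → Recurrent A d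
  recurrent-reach {c} {d} (unst , ret) p = unstable (ret d p) , λ e q → ret e (p ◅◅ q) ◅◅ p
    where
    -- The way back to `c` is either empty or starts with a firing that is legal at `e`.
    unstable : ∀ {e} → Reach A e c → Unstable A e
    unstable ε                     = unst
    unstable ((v , legal , _) ◅ _) = v , legal

  module Connected (conn : StronglyConnected A) where

    -- On a closed run the chip counts in `run-flow` cancel, leaving
    -- `count v l * A v w ≤ count w l * deg w` for an edge from `v` to `w`. If `v` fires, the left
    -- side is positive, so `w` fires too.
    cycle-spreads : ∀ {c l v w} → Run c l c → Path A v w → 0 < count v l → 0 < count w l
    cycle-spreads p ε v∈l = v∈l
    cycle-spreads {c} {l} {v} p (_◅_ {j = w} edge path) v∈l =
      cycle-spreads p path (n≢0⇒n>0 λ w∉l → <⇒≱ (*-mono-≤ v∈l edge) (≤-trans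
        (+-cancelˡ-≤ (lookup c w) _ _ (run-flow p v w))
        (≤-reflexive (cong (_* deg w) w∉l))))

    -- Recurrence closes the run that starts by firing an unstable vertex; strong connectivity
    -- spreads this firing to all vertices.
    recurrent⇒cycle : ∀ {c} → Recurrent A c → FullCycle c
    recurrent⇒cycle {c} ((v , legal) , ret)
      with reach⇒run (ret (fire A c v) ((v , legal , refl) ◅ ε))
    ... | l , p = v ∷ l , legal ∷ p , λ w → cycle-spreads (legal ∷ p) (conn v w)
      (≤-trans (≤-reflexive (sym (ind-self v))) (m≤m+n _ _))

    recurrent-⊕ : ∀ {c} x → Recurrent A c → Recurrent A (c ⊕ x)
    recurrent-⊕ x rec@((v , _) , _) = cycle⇒recurrent v (cycle-⊕ x (recurrent⇒cycle rec))

    -- Driving chips from the sink to all vertices.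

    fire-repeatedly : ∀ {x y} → 0 < A x y → y ≢ x → ∀ m c → m * deg x ≤ lookup c x →
      ∃ λ d → Reach A c d × m + lookup c y ≤ lookup d y
    fire-repeatedly edge y≢x zero c h = c , ε , ≤-refl
    fire-repeatedly {x} {y} edge y≢x (suc m) c h
      with fire-repeatedly edge y≢x m (fire A c x) left
      where
      left : m * deg x ≤ lookup (fire A c x) x
      left rewrite lookup-fire c x x | ind-self x | +-identityʳ (deg x) =
        ≤-trans (m+n≤o⇒n≤o∸m (deg x) h) (m≤m+n _ _)
        where
        m+n≤o⇒n≤o∸m : ∀ a {b o} → a + b ≤ o → b ≤ o ∸ a
        m+n≤o⇒n≤o∸m a {b} le = ≤-trans (≤-reflexive (sym (m+n∸m≡n a b))) (∸-monoˡ-≤ a le)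
    ... | d , p , h′ = d , (x , m+n≤o⇒m≤o (deg x) h , refl) ◅ p , (begin
        suc m + lookup c y             ≡⟨ +-suc m (lookup c y) ⟨
        m + suc (lookup c y)           ≤⟨ +-monoʳ-≤ m gain ⟩
        m + lookup (fire A c x) y      ≤⟨ h′ ⟩
        lookup d y                     ∎)
      where
      open ≤-Reasoning
      gain : suc (lookup c y) ≤ lookup (fire A c x) y
      gain rewrite lookup-fire c x y | ind-≢ y≢x =
        ≤-trans (≤-reflexive (+-comm 1 (lookup c y))) (+-monoʳ-≤ (lookup c y) edge)

    module Sink (s : Fin N) where

      Fillable : Fin N → Set
      Fillable v = ∀ m → ∃ λ M → ∃ λ e → Reach A (unit s M) e × m ≤ lookup e v

      -- Every chip demanded at `y` is paid for by one firing of `x`, hence the demand `m * deg x`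
      -- on `x`.
      fillable-edge : ∀ {x y} → 0 < A x y → Fillable x → Fillable y
      fillable-edge {x} {y} edge fx m with y ≟ x
      ... | yes refl = fx m
      ... | no y≢x with fx (m * deg x)
      ... | M , e , p , h with fire-repeatedly edge y≢x m e h
      ... | d , q , h′ = M , d , p ◅◅ q , ≤-trans (m≤m+n m _) h′

      fillable-path : ∀ {x y} → Path A x y → Fillable x → Fillable y
      fillable-path ε             f = f
      fillable-path (edge ◅ path) f = fillable-path path (fillable-edge edge f)

      fillable : ∀ v → Fillable v
      fillable v = fillable-path (conn s v) λ m →
        m , unit s m , ε , ≤-reflexive (sym (lookup∘update s (replicate _ 0) m))

      -- Separate piles on `s` serve the demands one after another, each treated as inert extra
      -- chips while another is spread. The family `g` lets the induction shrink while the vertex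
      -- set stays fixed.
      fill-family : ∀ t {k} (g : Fin k → Fin N) →
        ∃ λ M → ∃ λ e → Reach A (unit s M) e × (∀ i → lookup t (g i) ≤ lookup e (g i))
      fill-family t {zero}  g = 0 , unit s 0 , ε , λ ()
      fill-family t {suc k} g
        with fillable (g zero) (lookup t (g zero)) | fill-family t (g ∘ suc)
      ... | M₁ , e₁ , p₁ , h₁ | M₂ , e₂ , p₂ , h₂ = M₁ + M₂ , e₁ ⊕ e₂
        , subst (λ c → Reach A c (e₁ ⊕ e₂)) (unit-⊕ s M₁ M₂)
            (reach-⊕ (unit s M₂) p₁ ◅◅ subst₂ (Reach A) (⊕-comm (unit s M₂) e₁) (⊕-comm e₂ e₁) (reach-⊕ e₁ p₂))
        , λ { zero    → ≤-trans h₁ (≤-trans (m≤m+n _ _) (≤-reflexive (sym (lookup-⊕ e₁ e₂ (g zero)))))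
            ; (suc i) → ≤-trans (h₂ i) (≤-trans (m≤n+m _ _) (≤-reflexive (sym (lookup-⊕ e₁ e₂ (g (suc i)))))) }

      fill : ∀ t → ∃ λ M → ∃ λ e → Reach A (unit s M) e × (∀ v → lookup t v ≤ lookup e v)
      fill t = fill-family t λ v → v

      -- Termination of firing away from the sink.

      -- Chips that v sends along an edge v → w stay at w or leave it again by firing w,
      -- so a bound on the firings of w bounds those of v; follow a path to the sink.
      count-bound : ∀ {v} n → Path A v s →
        ∃ λ B → ∀ {c l d} → level c ≡ n → Run c l d → count s l ≡ 0 → count v l ≤ B
      count-bound n ε = 0 , λ _ _ s∉l → ≤-reflexive s∉l
      count-bound {v} n (_◅_ {j = w} edge path) with count-bound n path
      ... | B , h = n + B * deg w , λ {c} {l} {d} lvl p s∉l → begin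
        count v l                            ≤⟨ m≤m*n (count v l) (A v w) {{>-nonZero edge}} ⟩
        count v l * A v w                    ≤⟨ m≤n+m _ (lookup c w) ⟩
        lookup c w + count v l * A v w       ≤⟨ run-flow p v w ⟩
        lookup d w + count w l * deg w       ≤⟨ +-mono-≤ (lookup≤sum d w) (*-monoˡ-≤ (deg w) (h lvl p s∉l)) ⟩
        level d + B * deg w                  ≡⟨ cong (_+ B * deg w) (trans (level-run p) lvl) ⟩
        n + B * deg w                        ∎
        where open ≤-Reasoning

      length≡Σcount : ∀ l → length l ≡ sum (tabulate λ v → count v l)
      length≡Σcount [] = sym (trans (cong sum (zeros N)) (sum-replicate-0 N))
        where
        zeros : ∀ n → tabulate {n = n} (λ _ → 0) ≡ replicate n 0
        zeros zero    = refl
        zeros (suc n) = cong (0 ∷_) (zeros n)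
      length≡Σcount (x ∷ l) = begin
        suc (length l)                                       ≡⟨ cong suc (length≡Σcount l) ⟩
        1 + sum (tabulate λ v → count v l)                   ≡⟨ cong (_+ sum (tabulate λ v → count v l)) (sum-unit x 1) ⟨
        sum (unit x 1) + sum (tabulate λ v → count v l)      ≡⟨ sum-⊕ (unit x 1) _ ⟨
        sum (unit x 1 ⊕ tabulate λ v → count v l)            ≡⟨ cong sum (lookup-ext {c = unit x 1 ⊕ _} {tabulate _} pt) ⟩
        sum (tabulate λ v → count v (x ∷ l))                 ∎
        where
        open ≡-Reasoning
        pt : ∀ w → lookup (unit x 1 ⊕ tabulate (λ v → count v l)) w ≡ lookup (tabulate λ v → count v (x ∷ l)) w
        pt w rewrite lookup-⊕ (unit x 1) (tabulate λ v → count v l) w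
          | lookup∘tabulate (λ v → count v l) w = sym (lookup∘tabulate (λ v → count v (x ∷ l)) w)

      length-bound : ∀ n → ∃ λ B → ∀ {c l d} → level c ≡ n → Run c l d → count s l ≡ 0 → length l ≤ B
      length-bound n = sum (tabulate b) , λ {c} {l} lvl p s∉l →
        ≤-trans (≤-reflexive (length≡Σcount l)) (sum-mono (tabulate λ v → count v l) (tabulate b) λ w →
          subst₂ _≤_ (sym (lookup∘tabulate (λ v → count v l) w)) (sym (lookup∘tabulate b w))
            (proj₂ (count-bound n (conn w s)) lvl p s∉l))
        where
        b : Fin N → ℕ
        b w = proj₁ (count-bound n (conn w s))

      -- The step limit `m` makes greedy firing structurally recursive; comparison with
      -- `length-bound` then yields termination.
      stable-or-long : ∀ m c →
        (∃ λ l → ∃ λ d → Run c l d × count s l ≡ 0 × SStable A s d) ⊎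
        (∃ λ l → ∃ λ d → Run c l d × count s l ≡ 0 × length l ≡ m)
      stable-or-long zero    c = inj₂ ([] , c , [] , refl , refl)
      stable-or-long (suc m) c with any? (λ v → ¬? (v ≟ s) ×-dec (deg v ≤? lookup c v))
      ... | no none = inj₁ ([] , c , [] , refl , λ v v≢s → ≰⇒> λ le → none (v , v≢s , le))
      ... | yes (v , v≢s , legal) with stable-or-long m (fire A c v)
      ... | inj₁ (l , d , p , s∉l , st) =
        inj₁ (v ∷ l , d , legal ∷ p , trans (cong (_+ count s l) (ind-≢ (v≢s ∘ sym))) s∉l , st)
      ... | inj₂ (l , d , p , s∉l , len) =
        inj₂ (v ∷ l , d , legal ∷ p , trans (cong (_+ count s l) (ind-≢ (v≢s ∘ sym))) s∉l , cong suc len)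

      stabilise : ∀ c → ∃ λ d → Reach A c d × SStable A s d
      stabilise c with length-bound (level c)
      -- One step beyond the bound, so that a run of full length is impossible.
      ... | B , bound with stable-or-long (suc B) c
      ... | inj₁ (l , d , p , _ , st)      = d , run⇒reach p , st
      ... | inj₂ (l , d , p , s∉l , len) =
        contradiction (≤-trans (≤-reflexive (sym len)) (bound refl p s∉l)) 1+n≰n

      -- The sink model and its confluence.

      private
        sfire-at : ∀ c v w → ∃ λ x → lookup (sfire A s c v) w ≡ x
        sfire-at c v w = _ , lookup∘tabulate _ w

        sfire-at≡ : ∀ c v w → proj₁ (sfire-at c v w) ≡ lookup (fire A c v [ s ]≔ 0) w
        sfire-at≡ c v w with w ≟ s
        ... | yes refl = sym (lookup∘update w (fire A c v) 0)
        ... | no w≢s   = sym (lookup∘update′ w≢s (fire A c v) 0)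

        us-at : ∀ w → ∃ λ x → lookup (us A s) w ≡ x
        us-at w = _ , lookup∘tabulate _ w

      sfire≡ : ∀ c v → sfire A s c v ≡ fire A c v [ s ]≔ 0
      sfire≡ c v = lookup-ext λ w → trans (proj₂ (sfire-at c v w)) (sfire-at≡ c v w)

      lookup-us-s : lookup (us A s) s ≡ 0
      lookup-us-s = trans (proj₂ (us-at s)) lem
        where
        lem : proj₁ (us-at s) ≡ 0
        lem with s ≟ s
        ... | yes _  = refl
        ... | no s≢s = contradiction refl s≢s

      lookup-us-≢ : ∀ {w} → w ≢ s → lookup (us A s) w ≡ A s w
      lookup-us-≢ {w} w≢s = trans (proj₂ (us-at w)) lem
        where
        lem : proj₁ (us-at w) ≡ A s w
        lem with w ≟ s
        ... | yes w≡s = contradiction w≡s w≢s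
        ... | no _    = refl

      lookup-scale-s : ∀ k → lookup (scale k (us A s)) s ≡ 0
      lookup-scale-s k = trans (lookup∘tabulate _ s) (trans (cong (k *_) lookup-us-s) (*-zeroʳ k))

      fire-[]≔ : ∀ c {v} a → v ≢ s → fire A (c [ s ]≔ a) v ≡ fire A c v [ s ]≔ (a + A v s)
      fire-[]≔ c {v} a v≢s = lookup-ext pt
        where
        pt : ∀ w → lookup (fire A (c [ s ]≔ a) v) w ≡ lookup (fire A c v [ s ]≔ (a + A v s)) w
        pt w with w ≟ s
        ... | yes refl rewrite lookup-fire (c [ w ]≔ a) v w | ind-≢ (v≢s ∘ sym)
          | lookup∘update w c a | lookup∘update w (fire A c v) (a + A v w) = refl
        ... | no w≢s rewrite lookup-fire (c [ s ]≔ a) v w | lookup∘update′ w≢s c a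
          | lookup∘update′ w≢s (fire A c v) (a + A v s) | lookup-fire c v w = refl

      fire-drop : ∀ c {v} → v ≢ s → fire A (c [ s ]≔ 0) v [ s ]≔ 0 ≡ fire A c v [ s ]≔ 0
      fire-drop c {v} v≢s =
        trans (cong (_[ s ]≔ 0) (fire-[]≔ c 0 v≢s)) ([]≔-idempotent (fire A c v) s)

      sfire-comm : ∀ c {v w} → v ≢ s → w ≢ s → v ≢ w → deg v ≤ lookup c v → deg w ≤ lookup c w →
        sfire A s (sfire A s c v) w ≡ sfire A s (sfire A s c w) v
      sfire-comm c {v} {w} v≢s w≢s v≢w lv lw = trans (unfold c v w w≢s)
        (trans (cong (_[ s ]≔ 0) (fire-comm c v≢w lv lw)) (sym (unfold c w v v≢s)))
        where
        unfold : ∀ c v w → w ≢ s → sfire A s (sfire A s c v) w ≡ fire A (fire A c v) w [ s ]≔ 0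
        unfold c v w w≢s rewrite sfire≡ c v | sfire≡ (fire A c v [ s ]≔ 0) w = fire-drop (fire A c v) w≢s

      sfire-grows : ∀ c {v w} → w ≢ s → w ≢ v → lookup c w ≤ lookup (sfire A s c v) w
      sfire-grows c {v} w≢s w≢v rewrite sfire≡ c v | lookup∘update′ w≢s (fire A c v) 0 = fire-grows c w≢v

      -- A vertex legal at `c` must fire before stability is reached. If it fires first, the rest of
      -- the run serves; otherwise it commutes with the first firing and the argument repeats.
      sstep-confluent : ∀ {c d e} → SReach A s c d → SStable A s d → SStep A s c e → SReach A s e d
      sstep-confluent ε st (v , v≢s , lv , _) = contradiction lv (<⇒≱ (st v v≢s))
      sstep-confluent {c} ((w , w≢s , lw , refl) ◅ p) st (v , v≢s , lv , refl) with v ≟ w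
      ... | yes refl = p
      ... | no v≢w   =
        (w , w≢s , ≤-trans lw (sfire-grows c w≢s (v≢w ∘ sym)) , refl) ◅
        sstep-confluent p st (v , v≢s , ≤-trans lv (sfire-grows c v≢s v≢w) , sfire-comm c v≢s w≢s v≢w lv lw)

      sreach-confluent : ∀ {c d e} → SReach A s c d → SStable A s d → SReach A s c e → SReach A s e d
      sreach-confluent p st ε       = p
      sreach-confluent p st (x ◅ q) = sreach-confluent (sstep-confluent p st x) st q

      -- Translating runs between the two models.

      lift : ∀ {c d} → SReach A s c d → ∀ a → ∃ λ b → Reach A (c [ s ]≔ a) (d [ s ]≔ b)
      lift ε a = a , ε
      -- The `A v s` chips that the sink model discards pile up on `s`.
      lift {c} ((v , v≢s , lv , refl) ◅ p) a with lift p (a + A v s)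
      ... | b , q = b ,
        ( v , subst (deg v ≤_) (sym (lookup∘update′ v≢s c a)) lv
        , trans (trans (cong (_[ s ]≔ (a + A v s)) (sfire≡ c v)) ([]≔-idempotent (fire A c v) s))
                (sym (fire-[]≔ c a v≢s))) ◅ q

      []≔0-⊕ : ∀ c {x} → lookup x s ≡ 0 → (c ⊕ x) [ s ]≔ 0 ≡ (c [ s ]≔ 0) ⊕ x
      []≔0-⊕ c {x} xs = lookup-ext pt
        where
        pt : ∀ w → lookup ((c ⊕ x) [ s ]≔ 0) w ≡ lookup ((c [ s ]≔ 0) ⊕ x) w
        pt w rewrite lookup-⊕ (c [ s ]≔ 0) x w with w ≟ s
        ... | yes refl rewrite lookup∘update w (c ⊕ x) 0 | lookup∘update w c 0 = sym xs
        ... | no w≢s   rewrite lookup∘update′ w≢s (c ⊕ x) 0 | lookup∘update′ w≢s c 0 = lookup-⊕ c x w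

      fire-sink : ∀ c → fire A c s [ s ]≔ 0 ≡ (c [ s ]≔ 0) ⊕ us A s
      fire-sink c = lookup-ext pt
        where
        pt : ∀ w → lookup (fire A c s [ s ]≔ 0) w ≡ lookup ((c [ s ]≔ 0) ⊕ us A s) w
        pt w rewrite lookup-⊕ (c [ s ]≔ 0) (us A s) w with w ≟ s
        ... | yes refl rewrite lookup∘update w (fire A c w) 0 | lookup∘update w c 0 = sym lookup-us-s
        ... | no w≢s   rewrite lookup∘update′ w≢s (fire A c s) 0 | lookup∘update′ w≢s c 0
          | lookup-us-≢ w≢s | lookup-fire c s w | ind-≢ w≢s = refl

      -- All firings of the sink can be brought forward into a single initial addition of
      -- copies of us, because extra chips never obstruct a firing.
      project : ∀ {c l d} → Run c l d →
        SReach A s ((c [ s ]≔ 0) ⊕ scale (count s l) (us A s)) (d [ s ]≔ 0)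
      project {c} [] = subst (λ e → SReach A s e (c [ s ]≔ 0)) (sym (lookup-ext pt)) ε
        where
        pt : ∀ w → lookup ((c [ s ]≔ 0) ⊕ scale 0 (us A s)) w ≡ lookup (c [ s ]≔ 0) w
        pt w rewrite lookup-⊕ (c [ s ]≔ 0) (scale 0 (us A s)) w
          | lookup∘tabulate (λ w → 0 * lookup (us A s) w) w = +-identityʳ _
      project {c} {v ∷ l} {d} (legal ∷ p) with v ≟ s
      ... | yes refl rewrite ind-self v =
        subst (λ e → SReach A s e (d [ s ]≔ 0)) (lookup-ext pt) (project p)
        where
        k = count s l
        pt : ∀ w → lookup ((fire A c s [ s ]≔ 0) ⊕ scale k (us A s)) w ≡
                   lookup ((c [ s ]≔ 0) ⊕ scale (suc k) (us A s)) w
        pt w rewrite fire-sink c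
          | lookup-⊕ ((c [ s ]≔ 0) ⊕ us A s) (scale k (us A s)) w
          | lookup-⊕ (c [ s ]≔ 0) (us A s) w
          | lookup-⊕ (c [ s ]≔ 0) (scale (suc k) (us A s)) w
          | lookup∘tabulate (λ w → k * lookup (us A s) w) w
          | lookup∘tabulate (λ w → suc k * lookup (us A s) w) w = +-assoc (lookup (c [ s ]≔ 0) w) _ _
      ... | no v≢s rewrite ind-≢ (v≢s ∘ sym) = (v , v≢s , legal-⊕ c₀ x legal₀ , sym sfired) ◅ project p
        where
        x  = scale (count s l) (us A s)
        c₀ = c [ s ]≔ 0
        legal₀ : deg v ≤ lookup c₀ v
        legal₀ = subst (deg v ≤_) (sym (lookup∘update′ v≢s c 0)) legal
        sfired : sfire A s (c₀ ⊕ x) v ≡ (fire A c v [ s ]≔ 0) ⊕ x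
        sfired = trans (sfire≡ (c₀ ⊕ x) v) (trans (cong (_[ s ]≔ 0) (fire-⊕ c₀ x legal₀))
          (trans ([]≔0-⊕ (fire A c₀ v) (lookup-scale-s (count s l))) (cong (_⊕ x) (fire-drop c v≢s))))

      stop-at-sink : ∀ {c l d} → Run c l d → 0 < count s l →
        ∃ λ l′ → ∃ λ e → Run c l′ e × count s l′ ≡ 1
      stop-at-sink {c} {v ∷ l} (legal ∷ p) s∈l with v ≟ s
      ... | yes refl = s ∷ [] , fire A c s , legal ∷ [] , trans (+-identityʳ _) (ind-self s)
      ... | no v≢s with stop-at-sink p (subst (λ i → 0 < i + count s l) (ind-≢ (v≢s ∘ sym)) s∈l)
      ... | l′ , e , q , once = v ∷ l′ , e , legal ∷ q , trans (cong (_+ count s l′) (ind-≢ (v≢s ∘ sym))) once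

      fire-sink-times : ∀ {c} → Recurrent A c → ∀ k → ∃ λ l → ∃ λ e → Run c l e × count s l ≡ k
      fire-sink-times {c} rec zero = [] , c , [] , refl
      fire-sink-times rec (suc k) with fire-sink-times rec k
      ... | l , e , p , h with recurrent⇒cycle (recurrent-reach rec (run⇒reach p))
      ... | _ , cyc , full with stop-at-sink cyc (full s)
      ... | l′ , e′ , p′ , once = l ++ l′ , e′ , run-++ p p′ ,
        trans (count-++ s l l′) (trans (cong₂ _+_ h once) (+-comm k 1))

      -- A run with exactly `k` sink firings projects to a sink-model run from `c` plus `k` copies
      -- of `us`. By confluence its end continues to `d`, and this continuation is lifted with the
      -- chips that `e` has on `s`.
      sequiv⇒reach : ∀ {c d a} → SConfig s c → Recurrent A (c [ s ]≔ a) → SEquiv A s c d →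
        ∃ λ b → Reach A (c [ s ]≔ a) (d [ s ]≔ b)
      sequiv⇒reach {c} {d} {a} cs rec (k , q , st) with fire-sink-times rec k
      ... | l , e , p , refl with lift (sreach-confluent q st
              (subst (λ z → SReach A s (z ⊕ _) _) ([]≔-sconfig c s a cs) (project p))) (lookup e s)
      ... | b , r = b , run⇒reach p ◅◅ subst (λ z → Reach A z (d [ s ]≔ b))
              (trans ([]≔-idempotent e s) ([]≔-lookup e s)) r

      reach⇒sequiv : ∀ {c d a b} → SConfig s c → SConfig s d → SStable A s d →
        Reach A (c [ s ]≔ a) (d [ s ]≔ b) → SEquiv A s c d
      reach⇒sequiv {c} {d} {a} {b} cs ds st p with reach⇒run p
      ... | l , q = count s l ,
        subst₂ (λ x y → SReach A s (x ⊕ _) y) ([]≔-sconfig c s a cs) ([]≔-sconfig d s b ds) (project q) , st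

      -- Recurrence in the two models.

      srecurrent⇒stable : ∀ {c} → SRecurrent A s c → SStable A s c
      srecurrent⇒stable (_ , h) with h (replicate N 0) (lookup-replicate s 0)
      ... | _ , _ , _ , st = st

      -- Pour so many chips into s that d can grow beyond c₁; recurrence brings it back to d.
      recurrent⇒srecurrent : ∀ {d} → Recurrent A d → SStable A s d → SRecurrent A s (d [ s ]≔ 0)
      recurrent⇒srecurrent {d} rec st = lookup∘update s d 0 , λ c₁ c₁s → above c₁ c₁s (fill c₁)
        where
        st₀ : SStable A s (d [ s ]≔ 0)
        st₀ v v≢s rewrite lookup∘update′ v≢s d 0 = st v v≢s

        drop-unit : ∀ M → (d ⊕ unit s M) [ s ]≔ 0 ≡ d [ s ]≔ 0
        drop-unit M = trans (cong (λ z → (z ⊕ unit s M) [ s ]≔ 0) (sym ([]≔-lookup d s)))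
          (trans (cong (_[ s ]≔ 0) ([]≔-⊕-unit d s (lookup d s) M)) ([]≔-idempotent d s))

        above : ∀ c₁ → SConfig s c₁ →
          (∃ λ M → ∃ λ e → Reach A (unit s M) e × (∀ v → lookup c₁ v ≤ lookup e v)) →
          Σ (Config N) λ c₂ → SConfig s c₂ × Stabilizes A s (c₁ ⊕ c₂) (d [ s ]≔ 0)
        above c₁ c₁s (M , e , p , h)
          with reach⇒run (proj₂ (recurrent-⊕ (unit s M) rec) (d ⊕ e)
                 (subst₂ (Reach A) (⊕-comm (unit s M) d) (⊕-comm e d) (reach-⊕ d p)))
        -- `x` is the start of the projected way back; it dominates `c₁`, and the witness is the
        -- difference.
        ... | l , q = zipWith _∸_ x c₁ , c₂s
          , subst₂ (SReach A s) (sym (lookup-ext sum-x)) (drop-unit M) (project q) , st₀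
          where
          y x : Config N
          y = scale (count s l) (us A s)
          x = ((d ⊕ e) [ s ]≔ 0) ⊕ y
          c₂s : SConfig s (zipWith _∸_ x c₁)
          c₂s rewrite lookup-zipWith _∸_ s x c₁ | lookup-⊕ ((d ⊕ e) [ s ]≔ 0) y s
            | lookup∘update s (d ⊕ e) 0 | lookup-scale-s (count s l) = 0∸n≡0 (lookup c₁ s)
          c₁≤x : ∀ w → lookup c₁ w ≤ lookup x w
          c₁≤x w with w ≟ s
          ... | yes refl rewrite c₁s = z≤n
          ... | no w≢s rewrite lookup-⊕ ((d ⊕ e) [ s ]≔ 0) y w | lookup∘update′ w≢s (d ⊕ e) 0 | lookup-⊕ d e w =
            ≤-trans (h w) (≤-trans (m≤n+m _ (lookup d w)) (m≤m+n _ _))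
          sum-x : ∀ w → lookup (c₁ ⊕ zipWith _∸_ x c₁) w ≡ lookup x w
          sum-x w rewrite lookup-⊕ c₁ (zipWith _∸_ x c₁) w | lookup-zipWith _∸_ w x c₁ = m+[n∸m]≡n (c₁≤x w)

      -- In the sinkless model recurrence supplies a way back, so the equivalence is carried there
      -- and the reverse run projected.
      sequiv-sym : ∀ {c d a} → SRecurrent A s c → SRecurrent A s d → Recurrent A (c [ s ]≔ a) →
        SEquiv A s c d → SEquiv A s d c
      sequiv-sym srec-c srec-d rec eq with sequiv⇒reach (proj₁ srec-c) rec eq
      ... | b , p = reach⇒sequiv (proj₁ srec-d) (proj₁ srec-c) (srecurrent⇒stable srec-c) (proj₂ rec _ p)

      -- The s-level as a class invariant.

      index≤ : ∀ {c k a} → IsSIndex A s c k → Recurrent A (c [ s ]≔ a) → k ≤ a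
      index≤ {a = a} (_ , least) rec = ≮⇒≥ λ a<k → least a a<k rec

      -- From `c` with its index on `s`, the equivalence leads to a recurrent configuration
      -- consisting of `d` with `b` chips on `s`. So `b` is at least the index of `d`, while the
      -- level is conserved.
      slevel-mono : ∀ {c d m n} → SConfig s c → SConfig s d → SLevel A s c m → SLevel A s d n →
        SEquiv A s c d → n ≤ m
      slevel-mono {c} {d} {m} {n} cs ds (k , (rec , _) , m≡) (j , idx , n≡) eq with sequiv⇒reach cs rec eq
      ... | b , p = begin
        n                        ≡⟨ n≡ ⟩
        j + level d              ≤⟨ +-monoˡ-≤ (level d) (index≤ idx (recurrent-reach rec p)) ⟩
        b + level d              ≡⟨ sum-[]≔ d s b ds ⟨
        level (d [ s ]≔ b)       ≡⟨ level-reach p ⟩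
        level (c [ s ]≔ k)       ≡⟨ sum-[]≔ c s k cs ⟩
        k + level c              ≡⟨ m≡ ⟨
        m                        ∎
        where open ≤-Reasoning

      slevel-unique : ∀ {c d m n} → SRecurrent A s c → SRecurrent A s d →
        SLevel A s c m → SLevel A s d n → SEquiv A s c d → m ≡ n
      slevel-unique sc sd lc@(_ , (rec , _) , _) ld eq = ≤-antisym
        (slevel-mono (proj₁ sd) (proj₁ sc) ld lc (sequiv-sym sc sd rec eq))
        (slevel-mono (proj₁ sc) (proj₁ sd) lc ld eq)

      raise : ∀ {c k n} → SRecurrent A s c → (lvl : SLevel A s c k) → k ≤ n →
        let rep = c [ s ]≔ (proj₁ lvl + (n ∸ k)) in Recurrent A rep × level rep ≡ n
      raise {c} {k} {n} (cs , _) (χ , (rec , _) , k≡) k≤n =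
        subst (Recurrent A) ([]≔-⊕-unit c s χ (n ∸ k)) (recurrent-⊕ (unit s (n ∸ k)) rec) , (begin
          level (c [ s ]≔ (χ + (n ∸ k)))   ≡⟨ sum-[]≔ c s _ cs ⟩
          χ + (n ∸ k) + level c            ≡⟨ solve 3 (λ a b l → a :+ b :+ l := (a :+ l) :+ b) refl χ (n ∸ k) (level c) ⟩
          χ + level c + (n ∸ k)            ≡⟨ cong (_+ (n ∸ k)) k≡ ⟨
          k + (n ∸ k)                      ≡⟨ m+[n∸m]≡n k≤n ⟩
          n                                ∎)
        where
        open ≡-Reasoning
        open +-*-Solver

-- Comparing numbers of classes.

¬¬-least : (P : ℕ → Set) → ∀ {k} → P k → ¬ ¬ ∃ λ m → P m × (∀ j → j < m → ¬ P j)
¬¬-least P Pk none =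
  <-rec (λ k → ¬ P k) (λ k below Pk → none (k , Pk , λ j j<k → below j<k)) _ Pk

¬¬-choice : ∀ {n} {P : Fin n → Set} → (∀ i → ¬ ¬ P i) → ¬ ¬ (∀ i → P i)
¬¬-choice {zero}  h k = k λ ()
¬¬-choice {suc n} h k = h zero λ p → ¬¬-choice (h ∘ suc) λ ps → k λ { zero → p ; (suc i) → ps i }

-- Covering by g up to double negation suffices, because _≤_ is decidable and m is finite.
classCount-unique : ∀ {N} {P : Config N → Set} {R : Config N → Config N → Set} →
  (∀ {c d e} → R c d → R d e → R c e) → (∀ {c d} → P c → R c d → R d c) →
  ∀ {m n} → ClassCount P R m → (g : Fin n → Config N) → (∀ j → P (g j)) →
  (∀ i j → R (g i) (g j) → i ≡ j) → (∀ c → P c → ¬ ¬ ∃ λ j → R c (g j)) → m ≡ n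
classCount-unique {P = P} {R} R-trans R-sym {m} {n} (f , Pf , f-inj , f-cov) g Pg g-inj g-cov =
  ≤-antisym
    (decidable-stable (m ≤? n) λ m≰n → ¬¬-choice (λ i → g-cov (f i) (Pf i)) λ h →
      m≰n (embed f Pf f-inj g h))
    (embed g Pg g-inj f λ j → f-cov (g j) (Pg j))
  where
  -- Members `x i` and `x j` sharing one `y` are equivalent, hence `i ≡ j`, and the pigeonhole
  -- principle applies.
  embed : ∀ {a b} (x : Fin a → Config _) → (∀ i → P (x i)) → (∀ i j → R (x i) (x j) → i ≡ j) →
    (y : Fin b → Config _) → (∀ i → ∃ λ j → R (x i) (y j)) → a ≤ b
  embed x Px x-inj y h = injective⇒≤ {f = proj₁ ∘ h} λ {i} {j} eq →
    x-inj i j (R-trans (proj₂ (h i))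
      (subst (λ k → R (y k) (x j)) (sym eq) (R-sym (Px j) (proj₂ (h j)))))

-- Numbering the classes of s-level at most n.

module SumIndex (p : ℕ → ℕ) where

  Index : Set
  Index = Σ ℕ λ k → Fin (p k)

  decode : ∀ n → Fin (sumUpTo p n) → Index
  decode zero    i = 0 , i
  decode (suc n) i = [ decode n , suc n ,_ ]′ (splitAt (sumUpTo p n) i)

  decode-≤ : ∀ n i → proj₁ (decode n i) ≤ n
  decode-≤ zero    i = z≤n
  decode-≤ (suc n) i with splitAt (sumUpTo p n) i
  ... | inj₁ j = m≤n⇒m≤1+n (decode-≤ n j)
  ... | inj₂ j = ≤-refl

  -- `_≤′_` recurses from the same end as `sumUpTo`: its reflexive case is the last block, its step
  -- case an earlier one.
  decode-surjective : ∀ {n k} → k ≤′ n → (i : Fin (p k)) → ∃ λ j → decode n j ≡ (k , i)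
  decode-surjective {zero}  (≤′-reflexive refl) i = i , refl
  decode-surjective {suc n} (≤′-reflexive refl) i = sumUpTo p n ↑ʳ i ,
    cong [ decode n , suc n ,_ ]′ (splitAt-↑ʳ (sumUpTo p n) (p (suc n)) i)
  decode-surjective {suc n} (≤′-step k≤n) i with decode-surjective k≤n i
  ... | j , eq = j ↑ˡ p (suc n) ,
    trans (cong [ decode n , suc n ,_ ]′ (splitAt-↑ˡ (sumUpTo p n) j (p (suc n)))) eq

  decode-injective : ∀ n {i j} → decode n i ≡ decode n j → i ≡ j
  decode-injective zero    refl = refl
  decode-injective (suc n) {i} {j} eq
    with splitAt (sumUpTo p n) i in eqi | splitAt (sumUpTo p n) j in eqj
  ... | inj₁ i′ | inj₁ j′ = trans (sym (splitAt⁻¹-↑ˡ eqi))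
    (trans (cong (_↑ˡ p (suc n)) (decode-injective n eq)) (splitAt⁻¹-↑ˡ eqj))
  -- Earlier blocks carry levels at most `n` and the last one `suc n`, so the mixed cases are
  -- impossible.
  ... | inj₁ i′ | inj₂ j′ = contradiction (≤-trans (≤-reflexive (sym (cong proj₁ eq))) (decode-≤ n i′)) 1+n≰n
  ... | inj₂ i′ | inj₁ j′ = contradiction (≤-trans (≤-reflexive (cong proj₁ eq)) (decode-≤ n j′)) 1+n≰n
  decode-injective (suc n) {i} {j} refl | inj₂ i′ | inj₂ .i′ =
    trans (sym (splitAt⁻¹-↑ʳ eqi)) (splitAt⁻¹-↑ʳ eqj)

theorem4p1 : (N : ℕ) (A : Digraph N) → StronglyConnected A → (s : Fin N) →
    (r p : ℕ → ℕ) →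
    (∀ n → RecCount A n (r n)) →
    (∀ n → SRecCount A s n (p n)) →
    ∀ n → r n ≡ sumUpTo p n
theorem4p1 N A conn s r p hr hp n =
  classCount-unique _◅◅_ (λ Pc q → proj₂ (proj₁ Pc) _ q) (hr n)
    (rep ∘ decode n)
    (λ j → raise (proj₁ (f-rec (decode n j))) (proj₂ (f-rec (decode n j))) (decode-≤ n j))
    (λ i j q → decode-injective n (rep-injective (decode n i) (decode n j) q))
    cover
  where
  open Sandpile A
  open Connected conn
  open Sink s
  open SumIndex p

  f : Index → Config N
  f (k , i) = proj₁ (hp k) i

  f-rec : ∀ x → SRecurrent A s (f x) × SLevel A s (f x) (proj₁ x)
  f-rec (k , i) = proj₁ (proj₂ (hp k)) i

  -- The first summand is the s-index; for s-levels up to `n` the second one brings the level to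
  -- `n`.
  rep : Index → Config N
  rep x = f x [ s ]≔ (proj₁ (proj₂ (f-rec x)) + (n ∸ proj₁ x))

  -- The representatives in `hp` are known to be inequivalent only within one level, so equality of
  -- levels, supplied by `slevel-unique`, is a separate argument.
  f-injective : ∀ x y → proj₁ x ≡ proj₁ y → SEquiv A s (f x) (f y) → x ≡ y
  f-injective (k , i) (.k , j) refl eq = cong (k ,_) (proj₁ (proj₂ (proj₂ (hp k))) i j eq)

  rep-injective : ∀ x y → Reach A (rep x) (rep y) → x ≡ y
  rep-injective x y q with f-rec x | f-rec y
  ... | sx , lx | sy , ly = f-injective x y (slevel-unique sx sy lx ly eq) eq
    where
    eq : SEquiv A s (f x) (f y)
    eq = reach⇒sequiv (proj₁ sx) (proj₁ sy) (srecurrent⇒stable sy) q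

  cover : ∀ c → Recurrent A c × level c ≡ n → ¬ ¬ ∃ λ j → Reach A c (rep (decode n j))
  cover c (rec , lvl) none with stabilise c
  -- Recurrence has not been decided, so the s-index is obtained up to double negation, which is all
  -- that `classCount-unique` asks for.
  ... | d , q , st = ¬¬-least (λ k → Recurrent A (d₀ [ s ]≔ k)) rec₀ λ { (χ , idx) → none (found χ idx) }
    where
    d₀ = d [ s ]≔ 0
    a  = lookup d s
    d≡ : d₀ [ s ]≔ a ≡ d
    d≡ = trans ([]≔-idempotent d s) ([]≔-lookup d s)
    srec : SRecurrent A s d₀
    srec = recurrent⇒srecurrent (recurrent-reach rec q) st
    rec₀ : Recurrent A (d₀ [ s ]≔ a)
    rec₀ = subst (Recurrent A) (sym d≡) (recurrent-reach rec q)
    level-d : a + level d₀ ≡ n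
    level-d = trans (sym (sum-[]≔ d₀ s a (proj₁ srec)))
      (trans (cong level d≡) (trans (level-reach q) lvl))
    slevel≤n : ∀ {χ} → IsSIndex A s d₀ χ → χ + level d₀ ≤ n
    slevel≤n {χ} idx = subst (χ + level d₀ ≤_) level-d (+-monoˡ-≤ (level d₀) (index≤ idx rec₀))
    found : ∀ χ → IsSIndex A s d₀ χ → ∃ λ j → Reach A c (rep (decode n j))
    found χ idx with proj₂ (proj₂ (proj₂ (hp (χ + level d₀)))) d₀ (srec , χ , idx , refl)
    ... | i , eq with sequiv⇒reach (proj₁ srec) rec₀ eq
    ... | b , q′ with decode-surjective (≤⇒≤′ (slevel≤n idx)) i
    ... | j , dec = j , q ◅◅ subst₂ (Reach A) d≡ (trans (cong (f x [ s ]≔_) b≡) (cong rep (sym dec))) q′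
      where
      x : Index
      x = χ + level d₀ , i
      χ′ : ℕ
      χ′ = proj₁ (proj₂ (f-rec x)) + (n ∸ (χ + level d₀))
      fxs : SConfig s (f x)
      fxs = proj₁ (proj₁ (f-rec x))
      -- Conservation of level fixes `b`: `f x` with `b` chips on `s` and `rep x` both have level
      -- `n` and agree off `s`.
      b≡ : b ≡ χ′
      b≡ = +-cancelʳ-≡ (level (f x)) b χ′ (begin
        b + level (f x)         ≡⟨ sum-[]≔ (f x) s b fxs ⟨
        level (f x [ s ]≔ b)    ≡⟨ level-reach q′ ⟩
        level (d₀ [ s ]≔ a)     ≡⟨ sum-[]≔ d₀ s a (proj₁ srec) ⟩
        a + level d₀            ≡⟨ level-d ⟩
        n                       ≡⟨ proj₂ (raise (proj₁ (f-rec x)) (proj₂ (f-rec x)) (slevel≤n idx)) ⟨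
        level (rep x)           ≡⟨ sum-[]≔ (f x) s χ′ fxs ⟩
        χ′ + level (f x)        ∎)
        where open ≡-Reasoning
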